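{- Let $m \ge 2$ be even and $n \ge 4$ be even. The honeycomb toroidal graph $\mathrm{HTG}(m,n,0)$ is 2-spanning cyclable if and only if $n > 4$ or $(m,n) = (2,4)$.
   Context: For integers $m\ge 1$, $\ell\ge 0$ and $n\ge 4$ with $n$ even and $m-\ell$ even, the honeycomb toroidal graph $\mathrm{HTG}(m,n,\ell)$ is the simple graph with vertex set $\{u_{i,j}: 0\le i\le m-1,\ 0\le j\le n-1\}$ (first subscript computed modulo $m$, second modulo $n$) whose edge set is the set of the following unordered pairs: $\{u_{i,j},u_{i,j+1}\}$ for all $i,j$ (vertical edges); $\{u_{i,j},u_{i+1,j}\}$ for all $0\le i\le m-2$ with $i+j$ odd (flat edges); and $\{u_{m-1,j},u_{0,j+\ell}\}$ for all $j$ having the same parity as $m$ (and $\ell$) (jump edges). A 2-factor of a graph is a spanning subgraph in which every vertex has valency 2. A graph $X$ is 2-spanning cyclable if for every pair of distinct vertices $u,v$ of $X$ there is a 2-factor of $X$ consisting of exactly two cycles such that $u$ and $v$ lie in different cycles. -}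

module Defs where

open import Data.Nat using (ℕ; zero; suc; _+_; _*_; _∸_; _≤_; _%_)
open import Data.Fin using (Fin; toℕ)
open import Data.Product using (_×_; _,_; ∃; Σ)
open import Data.Sum using (_⊎_)
open import Data.List using (List; length; take; _++_)
open import Data.List.Membership.Propositional using (_∈_; _∉_)
open import Data.List.Relation.Unary.Unique.Propositional using (Unique)
open import Data.List.Relation.Unary.Linked using (Linked)
open import Relation.Binary.PropositionalEquality using (_≡_; _≢_)

Vertex : ℕ → ℕ → Set
Vertex m n = Fin m × Fin n

-- b ≡ a + 1 (mod n), for a b < n
SuccMod : ℕ → ℕ → ℕ → Set
SuccMod n a b = (b ≡ a + 1) ⊎ ((b ≡ 0) × (a + 1 ≡ n))

-- b ≡ a + ℓ (mod n), for b < n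
AddMod : ℕ → ℕ → ℕ → ℕ → Set
AddMod n ℓ a b = ∃ λ k → a + ℓ ≡ b + k * n

data HTGEdge (m n ℓ : ℕ) : Vertex m n → Vertex m n → Set where
  vertical : ∀ {i j j'} → SuccMod n (toℕ j) (toℕ j') →
             HTGEdge m n ℓ (i , j) (i , j')
  flat     : ∀ {i i' j} → toℕ i' ≡ toℕ i + 1 → (toℕ i + toℕ j) % 2 ≡ 1 →
             HTGEdge m n ℓ (i , j) (i' , j)
  jump     : ∀ {i i' j j'} → toℕ i ≡ m ∸ 1 → toℕ i' ≡ 0 →
             toℕ j % 2 ≡ m % 2 → AddMod n ℓ (toℕ j) (toℕ j') →
             HTGEdge m n ℓ (i , j) (i' , j')

Adj : (m n ℓ : ℕ) → Vertex m n → Vertex m n → Set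
Adj m n ℓ u v = HTGEdge m n ℓ u v ⊎ HTGEdge m n ℓ v u

record Cycle (V : Set) (A : V → V → Set) : Set where
  field
    verts    : List V
    len≥3    : 3 ≤ length verts
    distinct : Unique verts
    closed   : Linked A (verts ++ take 1 verts)
open Cycle public

record TwoCycleFactor (V : Set) (A : V → V → Set) : Set where
  field
    cyc₁     : Cycle V A
    cyc₂     : Cycle V A
    disjoint : ∀ x → x ∈ verts cyc₁ → x ∉ verts cyc₂
    spanning : ∀ x → x ∈ verts cyc₁ ⊎ x ∈ verts cyc₂
open TwoCycleFactor public

TwoSpanningCyclable : (V : Set) → (V → V → Set) → Set
TwoSpanningCyclable V A =
  ∀ (u v : V) → u ≢ v →
  Σ (TwoCycleFactor V A) λ F → u ∈ verts (cyc₁ F) × v ∈ verts (cyc₂ F)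

HTG2SC : ℕ → ℕ → ℕ → Set
HTG2SC m n ℓ = TwoSpanningCyclable (Vertex m n) (Adj m n ℓ)

{-# OPTIONS --safe #-}
module Submission where

-- If m ≥ 4 and n ≥ 6, any two vertices are separated by a hexagon through one of them that
-- misses the other, and the complement of every hexagon is a cycle.  If m = 2 the graph is a
-- prism over an n-cycle, where the two column cycles, or a square and the ring formed by the
-- other rows, do the job.  If n = 4 and m ≥ 4, the ends of a flat edge cannot be separated: the
-- two cycles would be forced to be the columns through its ends, missing all other columns.

open import Defs
open import Data.Nat using (ℕ; zero; suc; _+_; _∸_; _≤_; _<_; _%_; z≤n; s≤s; parity; _*_)
open import Data.Nat.Properties using (+-comm; +-identityʳ; m+n∸n≡m; ≤-trans; ≤-reflexive; n≤1+n; <-irrefl; suc-injective; m≤n⇒m<n∨m≡n; +-mono-≤)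
open import Data.Fin using (Fin; zero; suc; toℕ; inject₁; fromℕ)
open import Data.Fin.Patterns using (0F; 1F; 2F; 3F)
open import Data.Fin.Properties using (toℕ-injective; toℕ-inject₁; toℕ-fromℕ; toℕ<n; _≟_)
open import Data.Parity.Base as ℙ using (Parity; 0ℙ; 1ℙ; _⁻¹)
open import Data.Parity.Properties as ℙ using (+-homo-+; *-homo-*)
open import Data.List using (List; []; _∷_; _++_; map; reverse; take; length; tabulate; allFin; cartesianProduct)
open import Data.List.Properties using (map-++; length-tabulate; unfold-reverse; ++-identityʳ; length-++; length-map; length-reverse; ++-assoc)
open import Data.List.Membership.Propositional using (_∈_; _∉_)
open import Data.List.Membership.Propositional.Properties using (∈-∃++; ∈-++⁺ˡ; ∈-++⁺ʳ; ∈-++⁻; ∈-map⁺; ∈-cartesianProduct⁺; ∈-cartesianProduct⁻; ∈-allFin)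
open import Data.List.Relation.Unary.Any using (here; there)
open import Data.List.Relation.Unary.All as All using ([]; _∷_)
import Data.List.Relation.Unary.All.Properties as All
open import Data.List.Relation.Unary.AllPairs using ([]; _∷_)
open import Data.List.Relation.Unary.Linked using (Linked; []; [-]; _∷_)
open import Data.List.Relation.Unary.Unique.Propositional using (Unique)
open import Data.List.Relation.Unary.Unique.Propositional.Properties using (cartesianProduct⁺; allFin⁺; take⁺; Unique[x∷xs]⇒x∉xs)
open import Data.List.Relation.Binary.Permutation.Propositional using (_↭_; ↭-refl; ↭-sym; ↭-trans; ↭-reflexive; ↭⇒↭ₛ; module PermutationReasoning)
open import Data.List.Relation.Binary.Permutation.Propositional.Properties using (∈-resp-↭; ↭-length; ++⁺; ++⁺ˡ; ++⁺ʳ; ++-comm; ↭-reverse; ++-commutativeMonoid)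
import Data.List.Relation.Binary.Permutation.Setoid.Properties as Permutationₛ
open import Data.Product using (Σ; ∃; ∃₂; _×_; _,_; proj₁; proj₂)
open import Data.Sum using (_⊎_; inj₁; inj₂; swap; fromInj₁; fromInj₂) renaming ([_,_] to either)
open import Data.Empty using (⊥-elim)
open import Function using (_∘_)
open import Function.Bundles using (_⇔_; mk⇔)
open import Relation.Nullary using (¬_; yes; no; contradiction)
open import Relation.Binary.Definitions using (Symmetric)
open import Relation.Binary.PropositionalEquality using (_≡_; _≢_; refl; sym; trans; cong; cong₂; subst; setoid)
import Algebra.Solver.CommutativeMonoid as CMSolver

private
  variable
    V W : Set
    A B : V → V → Set

-- Duplicate-free lists under permutation and concatenation.

Unique-resp-↭ : {xs ys : List V} → xs ↭ ys → Unique xs → Unique ys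
Unique-resp-↭ p = Permutationₛ.Unique-resp-↭ (setoid _) (↭⇒↭ₛ p)

Unique-++⁻ : (xs : List V) {ys : List V} → Unique (xs ++ ys) →
             Unique xs × Unique ys × (∀ {v} → v ∈ xs → v ∉ ys)
Unique-++⁻ []       uys = [] , uys , λ ()
Unique-++⁻ (x ∷ xs) (x≢ ∷ u) with Unique-++⁻ xs u
... | uxs , uys , disj = All.++⁻ˡ xs x≢ ∷ uxs , uys , λ where
  (here refl) v∈ys → All.lookup (All.++⁻ʳ xs x≢) v∈ys refl
  (there v∈)  v∈ys → disj v∈ v∈ys

-- Paths, loops and cycles.

infixr 5 _∷_

-- The visited vertices form an index, so distinctness and coverage can be argued on lists, apart
-- from adjacency.
data Path {V : Set} (A : V → V → Set) : V → V → List V → Set where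
  [_] : ∀ x → Path A x x (x ∷ [])
  _∷_ : ∀ {x y z l} → A x y → Path A y z l → Path A x z (x ∷ l)

join : ∀ {x y z w k l} → Path A x y k → A y z → Path A z w l → Path A x w (k ++ l)
join [ _ ]   a q = a ∷ q
join (b ∷ p) a q = b ∷ join p a q

path-reverse : Symmetric A → ∀ {x y l} → Path A x y l → Path A y x (reverse l)
path-reverse s [ x ] = [ x ]
path-reverse s (_∷_ {x} {l = l} a p) =
  subst (Path _ _ _) (sym (unfold-reverse x l)) (join (path-reverse s p) (s a) [ x ])

path-map : (f : V → W) → (∀ {x y} → A x y → B (f x) (f y)) →
           ∀ {x y l} → Path A x y l → Path B (f x) (f y) (map f l)
path-map f h [ x ]   = [ f x ]
path-map f h (a ∷ p) = h a ∷ path-map f h p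

first∈ : ∀ {x y l} → Path A x y l → x ∈ l
first∈ [ _ ]   = here refl
first∈ (_ ∷ _) = here refl

last∈ : ∀ {x y l} → Path A x y l → y ∈ l
last∈ [ _ ]   = here refl
last∈ (_ ∷ p) = there (last∈ p)

simple-loop : ∀ {x l} → Path A x x l → Unique l → l ≡ x ∷ []
simple-loop [ _ ]   _ = refl
simple-loop (_ ∷ p) u = contradiction (last∈ p) (Unique[x∷xs]⇒x∉xs u)

path-split : ∀ {x z s} p {q} → Path A x z (p ++ s ∷ q) →
             Path A s z (s ∷ q) × ((p ≡ [] × x ≡ s) ⊎ (∃ λ y → Path A x y p × A y s))
path-split []      [ _ ]   = [ _ ] , inj₁ (refl , refl)
path-split []      (a ∷ r) = a ∷ r , inj₁ (refl , refl)
path-split (x ∷ []) (a ∷ r) with path-split [] r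
... | t , inj₁ (refl , refl)  = t , inj₂ (x , [ x ] , a)
path-split (x ∷ p@(_ ∷ _)) (a ∷ r) with path-split p r
... | t , inj₂ (y , k , b)    = t , inj₂ (y , a ∷ k , b)

-- Rotation changes the order of a tour, so `perm` ties it to `l` only as a multiset; distinctness
-- and length transfer along it.
record Loop (A : V → V → Set) (s : V) (l : List V) : Set where
  constructor loop
  field
    {end} : V
    {tour} : List V
    path  : Path A s end tour
    close : A end s
    perm  : tour ↭ l
open Loop

-- Cutting before `s` leaves a tail and an initial segment: the old closing edge joins them, and the
-- cut edge becomes the new closing edge.
rotate : ∀ {x z s l} → Path A x z l → A z x → s ∈ l → Loop A s l
rotate {s = s} r a s∈ with ∈-∃++ s∈
... | p , q , refl with path-split p r
...   | t , inj₁ (refl , refl) = loop t a ↭-refl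
...   | t , inj₂ (_ , k , b)   = loop (join t a k) b (++-comm (s ∷ q) p)

closed-path : ∀ {x y l} → Path A x y l → A y x → Linked A (l ++ take 1 l)
closed-path r a = subst (λ k → Linked _ (_ ++ k)) (sym (take-head r)) (go r a)
  where
  take-head : ∀ {x y l} → Path A x y l → take 1 l ≡ x ∷ []
  take-head [ _ ]   = refl
  take-head (_ ∷ _) = refl
  go : ∀ {x y w l} → Path A x y l → A y w → Linked A (l ++ w ∷ [])
  go [ _ ]               a = a ∷ [-]
  go (b ∷ p@([ _ ]))     a = b ∷ go p a
  go (b ∷ p@(_ ∷ _))     a = b ∷ go p a

linked-path : ∀ x l {w} → Linked A (x ∷ l ++ w ∷ []) → ∃ λ z → Path A x z (x ∷ l) × A z w
linked-path x []      (a ∷ [-]) = x , [ x ] , a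
linked-path x (y ∷ l) (a ∷ r) with linked-path y l r
... | z , p , b = z , a ∷ p , b

cycle-from : (C : Cycle V A) → ∀ {s} → s ∈ verts C → Loop A s (verts C)
cycle-from C s∈ with verts C | closed C
... | x ∷ l | r with linked-path x l r
...   | z , p , a = rotate p a s∈

-- Once the cycle starts at `x`, its second and last vertices serve; length at least 3 and
-- distinctness keep them apart.
neighbours : Symmetric A → (C : Cycle V A) → ∀ {x} → x ∈ verts C →
             ∃₂ λ y z → y ≢ z × A x y × A x z × y ∈ verts C × z ∈ verts C
neighbours {A = A} s C {x} x∈ = go (path L) (perm L) (close L)
  where
  L = cycle-from C x∈
  go : ∀ {z t} → Path A x z t → t ↭ verts C → A z x →
       ∃₂ λ y z → y ≢ z × A x y × A x z × y ∈ verts C × z ∈ verts C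
  go [ _ ] p _ = contradiction (subst (3 ≤_) (sym (↭-length p)) (len≥3 C)) λ { (s≤s ()) }
  go (_ ∷ [ _ ]) p _ = contradiction (subst (3 ≤_) (sym (↭-length p)) (len≥3 C)) λ { (s≤s (s≤s ())) }
  go (a ∷ r@(_ ∷ r′)) p b with Unique-resp-↭ (↭-sym p) (distinct C)
  ... | _ ∷ u = _ , _ , (λ { refl → Unique[x∷xs]⇒x∉xs u (last∈ r′) }) , a , s b ,
                ∈-resp-↭ p (there (here refl)) , ∈-resp-↭ p (there (last∈ r))

-- Both x and w sit between y and z on the cycle, so it closes up after x y w z.
four-cycle : Symmetric A → (C : Cycle V A) → ∀ {x w y z} → x ∈ verts C → w ∈ verts C →
             x ≢ w → w ≢ y → w ≢ z →
             (∀ {v} → v ∈ verts C → A x v → v ≡ y ⊎ v ≡ z) →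
             (∀ {v} → v ∈ verts C → A w v → v ≡ y ⊎ v ≡ z) →
             ∀ {v} → v ∈ verts C → v ≡ x ⊎ v ≡ w ⊎ v ≡ y ⊎ v ≡ z
four-cycle {A = A} sy C {x} {w} {y} {z} x∈ w∈ x≢w w≢y w≢z nx nw v∈ =
  go (path L) (perm L) (close L)
  where
  L = cycle-from C x∈
  yz→ends : ∀ {a b} → a ≢ b → a ≡ y ⊎ a ≡ z → b ≡ y ⊎ b ≡ z → ∀ {v} → v ≡ y ⊎ v ≡ z → v ≡ a ⊎ v ≡ b
  yz→ends a≢b (inj₁ refl) (inj₁ refl) _           = contradiction refl a≢b
  yz→ends a≢b (inj₁ refl) (inj₂ refl) v           = v
  yz→ends a≢b (inj₂ refl) (inj₁ refl) v           = swap v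
  yz→ends a≢b (inj₂ refl) (inj₂ refl) _           = contradiction refl a≢b
  ≢w : ∀ {a} → a ≡ y ⊎ a ≡ z → w ≢ a
  ≢w (inj₁ refl) = w≢y
  ≢w (inj₂ refl) = w≢z
  go : ∀ {e t} → Path A x e t → t ↭ verts C → A e x → _ ≡ x ⊎ _ ≡ w ⊎ _ ≡ y ⊎ _ ≡ z
  go [ _ ] p _ = contradiction (subst (3 ≤_) (sym (↭-length p)) (len≥3 C)) λ { (s≤s ()) }
  go (_ ∷ [ _ ]) p _ = contradiction (subst (3 ≤_) (sym (↭-length p)) (len≥3 C)) λ { (s≤s (s≤s ())) }
  go {e} (_∷_ {y = d} a r@(_ ∷ r′)) p b with Unique-resp-↭ (↭-sym p) (distinct C)
  ... | _ ∷ u with ∈-resp-↭ (↭-sym p) w∈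
  ...   | here w≡x = contradiction (sym w≡x) x≢w
  ...   | there w∈M = split w∈M r u (λ v∈ → ∈-resp-↭ p (there v∈)) (∈-resp-↭ (↭-sym p) v∈)
    where
    d≢e : d ≢ e
    d≢e refl = Unique[x∷xs]⇒x∉xs u (last∈ r′)
    -- The second vertex `d` and the last vertex `e` are `y` and `z` in some order, so they can
    -- replace `y` and `z` in the condition on `w`.
    dyz = nx (∈-resp-↭ p (there (here refl))) a
    eyz = nx (∈-resp-↭ p (there (last∈ r))) (sy b)
    nw′ : ∀ {v} → v ∈ verts C → A w v → v ≡ d ⊎ v ≡ e
    nw′ v∈ a = yz→ends d≢e dyz eyz (nw v∈ a)

    finish : ∀ {v} → v ∈ x ∷ d ∷ w ∷ e ∷ [] → v ≡ x ⊎ v ≡ w ⊎ v ≡ y ⊎ v ≡ z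
    finish (here v≡x) = inj₁ v≡x
    finish (there (here refl)) = inj₂ (inj₂ dyz)
    finish (there (there (here v≡w))) = inj₂ (inj₁ v≡w)
    finish (there (there (there (here refl)))) = inj₂ (inj₂ eyz)

    split : ∀ {M} → w ∈ M → Path A d e M → Unique M → (∀ {v} → v ∈ M → v ∈ verts C) →
            ∀ {v} → v ∈ x ∷ M → v ≡ x ⊎ v ≡ w ⊎ v ≡ y ⊎ v ≡ z
    split w∈M r u M⊆ v∈ with ∈-∃++ w∈M
    ... | k , q , refl with path-split k r | Unique-++⁻ k u
    ...   | _  , inj₁ (_ , d≡w)     | _ = contradiction (sym d≡w) (≢w dyz)
    ...   | qp , inj₂ (f , kp , fw) | uk , uq , disj
      -- The last vertex `e` cannot precede `w`, so `d` does; then `d` cannot follow `w`, so `e`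
      -- does, and the whole tour is `x`, `d`, `w`, `e`.
      with nw′ (M⊆ (∈-++⁺ˡ (last∈ kp))) (sy fw)
    ...     | inj₂ refl = contradiction (last∈ qp) (disj (last∈ kp))
    ...     | inj₁ refl with simple-loop kp uk | qp | uq
    ...       | refl | [ _ ] | _ = contradiction refl (≢w eyz)
    ...       | refl | g ∷ q′ | _ ∷ uq′ with nw′ (M⊆ (∈-++⁺ʳ k (there (first∈ q′)))) g
    ...         | inj₁ refl = contradiction (there (first∈ q′)) (disj (here refl))
    ...         | inj₂ refl with simple-loop q′ uq′
    ...           | refl = finish v∈

-- The cyclic order on `Fin n`.

Next : ∀ {n} → Fin n → Fin n → Set
Next {n} a b = SuccMod n (toℕ a) (toℕ b)

n+1≢0 : ∀ n → n + 1 ≢ 0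
n+1≢0 zero    ()
n+1≢0 (suc _) ()

next-functional : ∀ {n} {a b c : Fin n} → Next a b → Next a c → b ≡ c
next-functional (inj₁ p) (inj₁ q) = toℕ-injective (trans p (sym q))
next-functional (inj₂ (p , _)) (inj₂ (q , _)) = toℕ-injective (trans p (sym q))
next-functional {b = b} (inj₁ p) (inj₂ (_ , q)) = contradiction (toℕ<n b) (<-irrefl (trans p q))
next-functional {c = c} (inj₂ (_ , q)) (inj₁ p) = contradiction (toℕ<n c) (<-irrefl (trans p q))

path-tabulate : ∀ {k} (f : Fin (suc k) → V) → (∀ i → A (f (inject₁ i)) (f (suc i))) →
                Path A (f zero) (f (fromℕ k)) (tabulate f)
path-tabulate {k = zero}  f h = [ _ ]
path-tabulate {k = suc _} f h = h zero ∷ path-tabulate (f ∘ suc) (h ∘ suc)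

-- Rotating the closed enumeration of 0 to n - 1 gives a full tour from any start; such tours later
-- stand in for modular arithmetic on indices.
tour-from : ∀ {n} (s : Fin n) → Loop Next s (allFin n)
tour-from {suc k} s = rotate (path-tabulate {A = Next} (λ i → i) step) wrap (∈-allFin s)
  where
  step : ∀ i → Next {suc k} (inject₁ i) (suc i)
  step i = inj₁ (trans (+-comm 1 (toℕ i)) (cong (_+ 1) (sym (toℕ-inject₁ i))))
  wrap : Next {suc k} (fromℕ k) zero
  wrap = inj₂ (refl , trans (cong (_+ 1) (toℕ-fromℕ k)) (+-comm k 1))

module _ {n : ℕ} {s : Fin n} (L : Loop Next s (allFin n)) where

  tour-length : length (tour L) ≡ n
  tour-length = trans (↭-length (perm L)) (length-tabulate (λ i → i))

  tour-unique : Unique (tour L)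
  tour-unique = Unique-resp-↭ (↭-sym (perm L)) (allFin⁺ n)

  ∈-tour : ∀ i → i ∈ tour L
  ∈-tour i = ∈-resp-↭ (↭-sym (perm L)) (∈-allFin i)

prev : ∀ {n} (j : Fin n) → ∃ λ i → Next i j
prev j = _ , close (tour-from j)

successor : ∀ {x y l} → Path A x y l → A y x → ∃ (A x)
successor [ _ ]   a = _ , a
successor (a ∷ _) _ = _ , a

next : ∀ {n} (i : Fin n) → ∃ λ j → Next i j
next i = successor (path (tour-from i)) (close (tour-from i))

prefix : ∀ {n} {s x y : Fin n} {k l} → Path Next s x k → Path Next s y l →
         length k ≤ length l → k ≡ take (length k) l
prefix [ _ ]   [ _ ]   _ = refl
prefix [ _ ]   (_ ∷ _) _ = refl
prefix (_ ∷ [ _ ])   [ _ ] (s≤s ())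
prefix (_ ∷ (_ ∷ _)) [ _ ] (s≤s ())
prefix (a ∷ p) (b ∷ q) (s≤s h) with refl ← next-functional a b = cong (_ ∷_) (prefix p q h)

-- Successors are unique, so a path on at most `n` vertices is a prefix of the full tour, which
-- repeats nothing. This is how nearby indices are told apart.
short-path-unique : ∀ {n} {s x : Fin n} {k} → Path Next s x k → length k ≤ n → Unique k
short-path-unique {s = s} {k = k} p h =
  subst Unique (sym (prefix p (path L) (≤-trans h (≤-reflexive (sym (tour-length L))))))
    (take⁺ (length k) (tour-unique L))
  where L = tour-from s

-- The pair starting at `i` works unless `j` follows `i`; then the pair ending at `i` works, since
-- `3 ≤ n` makes the predecessor and successor of `i` distinct.
pair-avoiding : ∀ {n} → 3 ≤ n → (i j : Fin n) → i ≢ j →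
                ∃₂ λ a b → Next a b × i ∈ a ∷ b ∷ [] × j ∉ a ∷ b ∷ []
pair-avoiding 3≤n i j i≢j with prev i | next i
... | a , ai | b , ib with j ≟ b
...   | no j≢b = i , b , ib , here refl , λ where
  (here refl) → i≢j refl
  (there (here refl)) → j≢b refl
...   | yes refl with short-path-unique (ai ∷ ib ∷ [ b ]) 3≤n
...     | (_ ∷ a≢b ∷ []) ∷ _ = a , i , ai , there (here refl) , λ where
  (here refl) → a≢b refl
  (there (here refl)) → i≢j refl

-- The five consecutive elements `a`, `b`, `i`, `c`, `d` are distinct. The triple starting at `i`
-- works unless `j` is `c` or `d`, and then the triple ending at `i` works.
triple-avoiding : ∀ {n} → 5 ≤ n → (i j : Fin n) → i ≢ j →
                  ∃₂ λ a b → ∃ λ c → Next a b × Next b c × i ∈ a ∷ b ∷ c ∷ [] × j ∉ a ∷ b ∷ c ∷ []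
triple-avoiding 5≤n i j i≢j with prev i | next i
... | b , bi | c , ic with prev b | next c
...   | a , ab | d , cd with short-path-unique (ab ∷ bi ∷ ic ∷ cd ∷ [ d ]) 5≤n
...     | (_ ∷ _ ∷ a≢c ∷ a≢d ∷ []) ∷ (_ ∷ b≢c ∷ b≢d ∷ []) ∷ _ with j ≟ c | j ≟ d
...       | no j≢c | no j≢d = i , c , d , ic , cd , here refl , λ where
  (here refl) → i≢j refl
  (there (here refl)) → j≢c refl
  (there (there (here refl))) → j≢d refl
...       | yes refl | _ = a , b , i , ab , bi , there (there (here refl)) , λ where
  (here refl) → a≢c refl
  (there (here refl)) → b≢c refl
  (there (there (here refl))) → i≢j refl
...       | no _ | yes refl = a , b , i , ab , bi , there (there (here refl)) , λ where
  (here refl) → a≢d refl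
  (there (here refl)) → b≢d refl
  (there (there (here refl))) → i≢j refl

-- Parity of indices.

even⇒parity : ∀ n → n % 2 ≡ 0 → parity n ≡ 0ℙ
even⇒parity zero          _ = refl
even⇒parity (suc (suc n)) h = even⇒parity n h

parity⇒even : ∀ n → parity n ≡ 0ℙ → n % 2 ≡ 0
parity⇒even zero          _ = refl
parity⇒even (suc (suc n)) h = parity⇒even n h

parity⇒odd : ∀ n → parity n ≡ 1ℙ → n % 2 ≡ 1
parity⇒odd (suc zero)    _ = refl
parity⇒odd (suc (suc n)) h = parity⇒odd n h

parity-+1 : ∀ n → parity (n + 1) ≡ parity n ⁻¹
parity-+1 zero          = refl
parity-+1 (suc zero)    = refl
parity-+1 (suc (suc n)) = parity-+1 n

par : ∀ {n} → Fin n → Parity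
par = parity ∘ toℕ

infix 4 _⋈_

-- The two index sets may differ: for a column `i` and a row `j` this is the condition under which
-- `adj-horizontal` gives an edge from `(i , j)` to the next column.
_⋈_ : ∀ {m n} → Fin m → Fin n → Set
i ⋈ j = par i ≡ par j ⁻¹

opposite-or-equal : ∀ p q → p ≡ q ⁻¹ ⊎ p ≡ q
opposite-or-equal 0ℙ 0ℙ = inj₂ refl
opposite-or-equal 0ℙ 1ℙ = inj₁ refl
opposite-or-equal 1ℙ 0ℙ = inj₁ refl
opposite-or-equal 1ℙ 1ℙ = inj₂ refl

opposite-sym : ∀ p q → p ≡ q ⁻¹ → q ≡ p ⁻¹
opposite-sym 0ℙ 1ℙ _ = refl
opposite-sym 1ℙ 0ℙ _ = refl

opposite-trans₂ : ∀ {p q r} → p ≡ q ⁻¹ → q ≡ r ⁻¹ → p ≡ r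
opposite-trans₂ {r = 0ℙ} refl refl = refl
opposite-trans₂ {r = 1ℙ} refl refl = refl

opposite-trans₃ : ∀ {p q r s} → p ≡ q ⁻¹ → q ≡ r ⁻¹ → r ≡ s ⁻¹ → p ≡ s ⁻¹
opposite-trans₃ a b c = trans a (cong _⁻¹ (opposite-trans₂ b c))

opposite-irrefl : ∀ p → p ≢ p ⁻¹
opposite-irrefl 0ℙ ()
opposite-irrefl 1ℙ ()

opposite-+ : ∀ p q → p ≡ q ⁻¹ → p ℙ.+ q ≡ 1ℙ
opposite-+ 0ℙ 1ℙ _ = refl
opposite-+ 1ℙ 0ℙ _ = refl

-- The wrap-around step from n - 1 to 0 changes parity too, because `n` is even.
next-⋈ : ∀ {n} → parity n ≡ 0ℙ → {a b : Fin n} → Next a b → b ⋈ a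
next-⋈ _ {a} (inj₁ b≡a+1) = trans (cong parity b≡a+1) (parity-+1 (toℕ a))
next-⋈ e {a} (inj₂ (b≡0 , a+1≡n)) =
  trans (cong parity b≡0) (trans (sym e) (trans (cong parity (sym a+1≡n)) (parity-+1 (toℕ a))))

-- Edges of the graph, with flat and jump edges unified.

adj-sym : ∀ {m n ℓ} → Symmetric (Adj m n ℓ)
adj-sym = swap

adj-vertical : ∀ {m n ℓ} {i : Fin m} {j j′ : Fin n} → Next j j′ → Adj m n ℓ (i , j) (i , j′)
adj-vertical = inj₁ ∘ vertical

-- With zero shift and `m` even, jump edges continue the flat pattern around the torus: the last
-- column is odd, so `i ⋈ j` makes `j` even, as a jump requires.
adj-horizontal : ∀ {m n} → parity m ≡ 0ℙ → {i i′ : Fin m} {j : Fin n} → Next i i′ → i ⋈ j →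
                 Adj m n 0 (i , j) (i′ , j)
adj-horizontal em {i} {j = j} (inj₁ i′≡i+1) i⋈j = inj₁ (flat i′≡i+1
  (parity⇒odd (toℕ i + toℕ j) (trans (+-homo-+ (toℕ i) (toℕ j)) (opposite-+ _ _ i⋈j))))
adj-horizontal {m} em {i} {j = j} (inj₂ (i′≡0 , i+1≡m)) i⋈j = inj₁ (jump
  (trans (sym (m+n∸n≡m (toℕ i) 1)) (cong (_∸ 1) i+1≡m)) i′≡0
  (trans (parity⇒even (toℕ j) (trans (sym (opposite-trans₂ m⋈i i⋈j)) em)) (sym (parity⇒even m em)))
  (0 , refl))
  where
  m⋈i : parity m ≡ par i ⁻¹
  m⋈i = trans (cong parity (sym i+1≡m)) (parity-+1 (toℕ i))

-- Rings and two-cycle factors.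

column : ∀ {m n} → Fin m → List (Fin n) → List (Vertex m n)
column i = map (i ,_)

-- Along column `i` and back along column `i′`; three rows give a hexagon, two rows a square.
ring : ∀ {m n} → Fin m → Fin m → List (Fin n) → List (Vertex m n)
ring i i′ ys = column i ys ++ reverse (column i′ ys)

ring-↭ : ∀ {m n} (i i′ : Fin m) (ys : List (Fin n)) →
         ring i i′ ys ↭ cartesianProduct (i ∷ i′ ∷ []) ys
ring-↭ i i′ ys = ++⁺ˡ (column i ys)
  (↭-trans (↭-reverse (column i′ ys)) (↭-reflexive (sym (++-identityʳ (column i′ ys)))))

-- Distinctness, disjointness and spanning all follow from one fact: `k ++ l` rearranges the full
-- grid, which lists every vertex once.
two-cycle-factor : ∀ {m n x y x′ y′ k l xs ys} {A : Vertex m n → Vertex m n → Set} →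
                   Path A x y k → A y x → 3 ≤ length k →
                   Path A x′ y′ l → A y′ x′ → 3 ≤ length l →
                   k ++ l ↭ cartesianProduct xs ys → xs ↭ allFin m → ys ↭ allFin n →
                   TwoCycleFactor (Vertex m n) A
two-cycle-factor {m} {n} {k = k} {l} p a hk q b hl perm xs↭ ys↭
  with Unique-++⁻ k (Unique-resp-↭ (↭-sym perm)
         (cartesianProduct⁺ (Unique-resp-↭ (↭-sym xs↭) (allFin⁺ m)) (Unique-resp-↭ (↭-sym ys↭) (allFin⁺ n))))
... | uk , ul , disj = record
  { cyc₁ = record { verts = k ; len≥3 = hk ; distinct = uk ; closed = closed-path p a }
  ; cyc₂ = record { verts = l ; len≥3 = hl ; distinct = ul ; closed = closed-path q b }
  ; disjoint = λ _ → disj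
  ; spanning = λ { (i , j) → ∈-++⁻ k (∈-resp-↭ (↭-sym perm)
      (∈-cartesianProduct⁺ (∈-resp-↭ (↭-sym xs↭) (∈-allFin i)) (∈-resp-↭ (↭-sym ys↭) (∈-allFin j)))) }
  }

module _ {m n : ℕ} where

  Separable : Vertex m n → Vertex m n → Set
  Separable u v = Σ (TwoCycleFactor (Vertex m n) (Adj m n 0)) λ F →
                  u ∈ verts (cyc₁ F) × v ∈ verts (cyc₂ F)

  private
    _~_ : Vertex m n → Vertex m n → Set
    _~_ = Adj m n 0

  RingFactor : Fin m → Fin m → List (Fin n) → Set
  RingFactor c d ys = Σ (TwoCycleFactor (Vertex m n) _~_) λ F → verts (cyc₁ F) ≡ ring c d ys

  -- The ring fills a product of columns and rows, so one bad coordinate puts the second vertex off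
  -- it, and spanning leaves only the other cycle.
  ring-separates : ∀ {c d ys} → RingFactor c d ys → ∀ {i j i′ j′} →
                   i ∈ c ∷ d ∷ [] → j ∈ ys → i′ ∉ c ∷ d ∷ [] ⊎ j′ ∉ ys → Separable (i , j) (i′ , j′)
  ring-separates {c} {d} {ys} (F , eq) {i′ = i′} {j′} i∈ j∈ out = F , u∈ , v∈
    where
    u∈ = subst (_ ∈_) (sym eq) (∈-resp-↭ (↭-sym (ring-↭ c d ys)) (∈-cartesianProduct⁺ i∈ j∈))
    v∈ : (i′ , j′) ∈ verts (cyc₂ F)
    v∈ with spanning F (i′ , j′)
    ... | inj₂ v∈ = v∈
    ... | inj₁ v∈ with ∈-cartesianProduct⁻ _ _ (∈-resp-↭ (ring-↭ c d ys) (subst (_ ∈_) eq v∈))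
    ...   | i′∈ , j′∈ = ⊥-elim (either (λ i′∉ → i′∉ i′∈) (λ j′∉ → j′∉ j′∈) out)

  -- Paths along columns, rings and snakes.

  path-column : ∀ i {x y ys} → Path Next x y ys → Path _~_ (i , x) (i , y) (column i ys)
  path-column i = path-map (i ,_) adj-vertical

  path-column-reverse : ∀ i {x y ys} → Path Next x y ys → Path _~_ (i , y) (i , x) (reverse (column i ys))
  path-column-reverse i p = path-reverse adj-sym (path-column i p)

  path-ring : ∀ {i i′ x y ys} → Path Next x y ys → (i , y) ~ (i′ , y) →
              Path _~_ (i , x) (i′ , x) (ring i i′ ys)
  path-ring p a = join (path-column _ p) a (path-column-reverse _ p)

  -- Columns are taken in pairs, the first against the order of `ys` and the second along it, so
  -- every pair starts at the same row.
  snake : List (Fin n) → List (Fin m) → List (Vertex m n)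
  snake ys []           = []
  snake ys (c ∷ [])     = column c ys
  snake ys (c ∷ d ∷ xs) = reverse (column c ys) ++ column d ys ++ snake ys xs

  snake-↭ : ∀ ys xs → snake ys xs ↭ cartesianProduct xs ys
  snake-↭ ys []           = ↭-refl
  snake-↭ ys (c ∷ [])     = ↭-reflexive (sym (++-identityʳ (column c ys)))
  snake-↭ ys (c ∷ d ∷ xs) = ++⁺ (↭-reverse (column c ys)) (++⁺ˡ (column d ys) (snake-↭ ys xs))

  module _ (em : parity m ≡ 0ℙ) where

    -- Crossings alternate between row `x`, inside a pair, and row `y`, between pairs; the parities
    -- make both available. The condition `d ⋈ c` forces an even number of columns, so the path ends
    -- in row `y` again.
    path-snake : ∀ {c d x y xs ys} → Path Next c d xs → d ⋈ c → Path Next x y ys →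
                 c ⋈ x → x ⋈ y → Path _~_ (c , y) (d , y) (snake ys xs)
    path-snake [ c ] c⋈c _ _ _ = contradiction c⋈c (opposite-irrefl (par c))
    path-snake {ys = ys} (_∷_ {x = c} e [ d ]) _ p c⋈x _ =
      join (path-column-reverse c p) (adj-horizontal em e c⋈x)
        (subst (Path _ _ _) (sym (++-identityʳ (column d ys))) (path-column d p))
    path-snake (_∷_ {x = c} e (_∷_ {x = d} f q)) z⋈c p c⋈x x⋈y =
      join (path-column-reverse c p) (adj-horizontal em e c⋈x)
        (join (path-column d p) (adj-horizontal em f (opposite-trans₃ (next-⋈ em e) c⋈x x⋈y))
          (path-snake q (trans z⋈c (cong _⁻¹ (sym c≡c″))) p (trans c≡c″ c⋈x) x⋈y))
      where c≡c″ = opposite-trans₂ (next-⋈ em f) (next-⋈ em e)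

  -- Hexagons and their complements.

  grid-++ : ∀ (xs : List (Fin m)) (ys zs : List (Fin n)) →
            cartesianProduct xs (ys ++ zs) ↭ cartesianProduct xs ys ++ cartesianProduct xs zs
  grid-++ []       ys zs = ↭-refl
  grid-++ (x ∷ xs) ys zs = begin
    map (x ,_) (ys ++ zs) ++ cartesianProduct xs (ys ++ zs)
      ↭⟨ ++⁺ (↭-reflexive (map-++ (x ,_) ys zs)) (grid-++ xs ys zs) ⟩
    (column x ys ++ column x zs) ++ cartesianProduct xs ys ++ cartesianProduct xs zs
      ↭⟨ solve 4 (λ a b c d → ((a ⊕ b) ⊕ (c ⊕ d)) ⊜ ((a ⊕ c) ⊕ (b ⊕ d))) ↭-refl
           (column x ys) (column x zs) (cartesianProduct xs ys) (cartesianProduct xs zs) ⟩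
    (column x ys ++ cartesianProduct xs ys) ++ column x zs ++ cartesianProduct xs zs ∎
    where
    open PermutationReasoning
    open CMSolver (++-commutativeMonoid {A = Vertex m n})

  -- The complement of the hexagon on columns c, d and rows hs is a single cycle: from the rest of
  -- column d snake through xs in the rows zs, and come back along the rest of column c through xs
  -- in the first four rows hs ++ t ∷ [].
  hexagon-complement-↭ : ∀ c d (xs : List (Fin m)) (hs : List (Fin n)) t (zs : List (Fin n)) →
    ring c d hs ++ (column d (t ∷ zs) ++ snake zs xs) ++
      reverse (snake (hs ++ t ∷ []) xs ++ column c (t ∷ zs))
    ↭ cartesianProduct (c ∷ d ∷ xs) (hs ++ t ∷ zs)
  hexagon-complement-↭ c d xs hs t zs = begin
    (column c hs ++ reverse (column d hs)) ++ (D ++ snake zs xs) ++ reverse (snake ts xs ++ C)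
      ↭⟨ ++⁺ (++⁺ˡ (column c hs) (↭-reverse (column d hs)))
           (++⁺ (++⁺ˡ D (snake-↭ zs xs))
             (↭-trans (↭-reverse (snake ts xs ++ C)) (++⁺ʳ C (snake-↭ ts xs)))) ⟩
    (column c hs ++ column d hs) ++ (D ++ Z) ++ (T ++ C)
      ↭⟨ solve 6 (λ a b c d e f → ((a ⊕ b) ⊕ ((d ⊕ f) ⊕ (e ⊕ c))) ⊜ ((a ⊕ c) ⊕ ((b ⊕ d) ⊕ (e ⊕ f)))) ↭-refl
           (column c hs) (column d hs) C D T Z ⟩
    (column c hs ++ C) ++ (column d hs ++ D) ++ (T ++ Z)
      ↭⟨ ++⁺ (↭-reflexive (sym (map-++ (c ,_) hs (t ∷ zs))))
           (++⁺ (↭-reflexive (sym (map-++ (d ,_) hs (t ∷ zs))))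
             (↭-trans (↭-sym (grid-++ xs ts zs))
               (↭-reflexive (cong (cartesianProduct xs) (++-assoc hs (t ∷ []) zs))))) ⟩
    cartesianProduct (c ∷ d ∷ xs) (hs ++ t ∷ zs) ∎
    where
    open PermutationReasoning
    open CMSolver (++-commutativeMonoid {A = Vertex m n})
    ts = hs ++ t ∷ []
    C = column c (t ∷ zs)
    D = column d (t ∷ zs)
    T = cartesianProduct xs ts
    Z = cartesianProduct xs zs

head-first : ∀ {x y l} → Path A x y l → ∃ λ k → l ≡ x ∷ k
head-first [ _ ]   = _ , refl
head-first (_ ∷ _) = _ , refl

uncons : ∀ {x y l} → Path A x y l → 2 ≤ length l →
         ∃₂ λ z k → l ≡ x ∷ k × A x z × Path A z y k
uncons [ _ ]   (s≤s ())
uncons (a ∷ p) _ = _ , _ , refl , a , p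

length-ring : ∀ {m n} (c d : Fin m) (ys : List (Fin n)) → length (ring c d ys) ≡ length ys + length ys
length-ring c d ys = trans (length-++ (column c ys)) (cong₂ _+_ (length-map (c ,_) ys)
  (trans (length-reverse (column d ys)) (length-map (d ,_) ys)))

-- Parity fixes the crossings. Columns `c` and `d` are joined in rows `x` and `z`. The second cycle
-- passes between `d` and its successor, and between `c` and its predecessor, in the fourth row and
-- in the last row of the tour from `x`.
hexagon-factor : ∀ {m n} → parity m ≡ 0ℙ → parity n ≡ 0ℙ → 3 ≤ m → 6 ≤ n →
                 {c d : Fin m} {x y z : Fin n} → Next c d → Next x y → Next y z → c ⋈ x →
                 RingFactor c d (x ∷ y ∷ z ∷ [])
hexagon-factor {m} {n} em en 3≤m 6≤n {c} {d} {x} {y} {z} cd xy yz c⋈x =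
  build (path cols) (close cols) (perm cols) (subst (3 ≤_) (sym (tour-length cols)) 3≤m)
        (path rows) (close rows) (perm rows) (subst (6 ≤_) (sym (tour-length rows)) 6≤n)
  where
  cols = tour-from c
  rows = tour-from x
  -- With the tours as variables, matching exposes columns `c`, `d`, `e`, ..., `l` and rows `x`,
  -- `y`, `z`, `t`, `a`, `b`, ..., `w`.
  build : ∀ {l w xs ys} → Path Next c l xs → Next l c → xs ↭ allFin m → 3 ≤ length xs →
          Path Next x w ys → Next w x → ys ↭ allFin n → 6 ≤ length ys →
          RingFactor c d (x ∷ y ∷ z ∷ [])
  build p lc pc 3≤ r wx pr 6≤
    with _ , _ , refl , cd′ , p₁ ← uncons p (≤-trans (s≤s (s≤s z≤n)) 3≤)
    with refl ← next-functional cd cd′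
    with s≤s 2≤ ← 3≤
    with e , xs , refl , de , p₂ ← uncons p₁ 2≤
    with _ , _ , refl , xy′ , r₁ ← uncons r (≤-trans (s≤s (s≤s z≤n)) 6≤)
    with refl ← next-functional xy xy′
    with s≤s 5≤ ← 6≤
    with _ , _ , refl , yz′ , r₂ ← uncons r₁ (≤-trans (s≤s (s≤s z≤n)) 5≤)
    with refl ← next-functional yz yz′
    with s≤s 4≤ ← 5≤
    with t , _ , refl , zt , r₃ ← uncons r₂ (≤-trans (s≤s (s≤s z≤n)) 4≤)
    with s≤s 3≤′ ← 4≤
    with a , _ , refl , ta , r₄ ← uncons r₃ (≤-trans (s≤s (s≤s z≤n)) 3≤′)
    with s≤s 2≤′ ← 3≤′
    with b , _ , refl , _ , r₅ ← uncons r₄ 2≤′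
    with zs , refl ← head-first r₅
    = two-cycle-factor
        (path-ring (xy ∷ yz ∷ [ z ]) (adj-horizontal em cd c⋈z))
        (adj-sym (adj-horizontal em cd c⋈x))
        (s≤s (s≤s (s≤s z≤n)))
        (join (join (path-column d r₃) (adj-horizontal em de (opposite-trans₃ d⋈c c⋈x x⋈w))
                (path-snake em p₂ l⋈e r₄ (opposite-trans₃ e⋈d d⋈c c⋈a) a⋈w))
              (adj-horizontal em lc (opposite-trans₃ l⋈c c⋈x x⋈w))
              (path-reverse adj-sym
                (join (path-snake em p₂ l⋈e (xy ∷ yz ∷ zt ∷ [ t ]) (opposite-trans₃ e⋈d d⋈c c⋈x) x⋈t)
                      (adj-horizontal em lc (opposite-trans₃ l⋈c c⋈x x⋈t))
                      (path-column c r₃))))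
        (adj-sym (adj-horizontal em de (opposite-trans₃ d⋈c c⋈x x⋈t)))
        -- The three vertices counted are those of column `d` in rows `t`, `a` and `b`.
        (s≤s (s≤s (s≤s z≤n)))
        (hexagon-complement-↭ c d xs (x ∷ y ∷ z ∷ []) t (a ∷ b ∷ zs)) pc pr , refl
    where
    x⋈w = next-⋈ en wx
    d⋈c = next-⋈ em cd
    e⋈d = next-⋈ em de
    l⋈c = opposite-sym _ _ (next-⋈ em lc)
    l⋈e = trans l⋈c (cong _⁻¹ (sym (opposite-trans₂ e⋈d d⋈c)))
    t⋈x = opposite-trans₃ (next-⋈ en zt) (next-⋈ en yz) (next-⋈ en xy)
    x⋈t = opposite-sym _ _ t⋈x
    a≡x = opposite-trans₂ (next-⋈ en ta) t⋈x
    a⋈w = trans a≡x x⋈w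
    c⋈a = trans c⋈x (cong _⁻¹ (sym a≡x))
    c⋈z = trans c⋈x (cong _⁻¹ (sym (opposite-trans₂ (next-⋈ en yz) (next-⋈ en xy))))

-- The prism case m = 2.

other-column : (i : Fin 2) → ∃ λ d → Next i d × Next d i × i ∷ d ∷ [] ↭ allFin 2
other-column zero       = suc zero , inj₁ refl , inj₂ (refl , refl) , ↭-refl
other-column (suc zero) = zero , inj₂ (refl , refl) , inj₁ refl , ++-comm (suc zero ∷ []) (zero ∷ [])

-- Odd rows supply a flat edge and even rows a jump edge, read in whichever direction is wanted.
rung : ∀ {n} {c d : Fin 2} → Next c d → Next d c → (j : Fin n) → Adj 2 n 0 (c , j) (d , j)
rung {c = c} cd dc j with opposite-or-equal (par c) (par j)
... | inj₁ c⋈j = adj-horizontal refl cd c⋈j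
... | inj₂ c≡j = adj-sym (adj-horizontal refl dc (trans (next-⋈ refl cd) (cong _⁻¹ c≡j)))

-- The rows other than `x` and `y` form the second ring; `4 ≤ n` leaves at least two of them.
square-factor : ∀ {n} → 4 ≤ n → {c d : Fin 2} → Next c d → Next d c → c ∷ d ∷ [] ↭ allFin 2 →
                {x y : Fin n} → Next x y → RingFactor c d (x ∷ y ∷ [])
square-factor {n} 4≤n {c} {d} cd dc pc {x} {y} xy =
  build (path rows) (perm rows) (subst (4 ≤_) (sym (tour-length rows)) 4≤n)
  where
  rows = tour-from x
  build : ∀ {w ys} → Path Next x w ys → ys ↭ allFin n → 4 ≤ length ys → RingFactor c d (x ∷ y ∷ [])
  build r pr 4≤
    with _ , _ , refl , xy′ , r₁ ← uncons r (≤-trans (s≤s (s≤s z≤n)) 4≤)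
    with refl ← next-functional xy xy′
    with s≤s 3≤ ← 4≤
    with z , zs , refl , _ , r₂ ← uncons r₁ (≤-trans (s≤s (s≤s z≤n)) 3≤)
    with s≤s 2≤ ← 3≤
    = two-cycle-factor
        (path-ring (xy ∷ [ y ]) (rung cd dc y)) (adj-sym (rung cd dc x)) (s≤s (s≤s (s≤s z≤n)))
        (path-ring r₂ (rung cd dc _)) (adj-sym (rung cd dc z))
        (≤-trans (n≤1+n 3) (≤-trans (+-mono-≤ 2≤ 2≤) (≤-reflexive (sym (length-ring c d zs)))))
        (↭-trans (++⁺ (ring-↭ c d (x ∷ y ∷ [])) (ring-↭ c d zs)) (↭-sym (grid-++ (c ∷ d ∷ []) (x ∷ y ∷ []) zs)))
        pc pr , refl

separable-prism : ∀ {n} → 4 ≤ n → (u v : Vertex 2 n) → u ≢ v → Separable u v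
separable-prism {n} 4≤n (i , j) (i′ , j′) u≢v with other-column i
... | d , id , di , pc with i ≟ i′
...   | yes refl with pair-avoiding (≤-trans (n≤1+n 3) 4≤n) j j′ (λ { refl → u≢v refl })
...     | x , y , xy , j∈ , j′∉ =
          ring-separates (square-factor 4≤n id di pc xy) (here refl) j∈ (inj₂ j′∉)
separable-prism {n} 4≤n (i , j) (i′ , j′) u≢v | d , id , di , pc | no i≢i′
  with ∈-resp-↭ (↭-sym pc) (∈-allFin i′)
... | here i′≡i = contradiction (sym i′≡i) i≢i′
... | there (here refl) =
      two-cycle-factor (path-column i (path rows)) (adj-vertical (close rows)) (3≤ i)
        (path-column d (path rows)) (adj-vertical (close rows)) (3≤ d)
        (++⁺ˡ (column i (tour rows)) (↭-reflexive (sym (++-identityʳ _)))) pc (perm rows)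
      , ∈-map⁺ (i ,_) (∈-tour rows j) , ∈-map⁺ (d ,_) (∈-tour rows j′)
  where
  rows = tour-from j
  3≤ : ∀ (c : Fin 2) → 3 ≤ length (column c (tour rows))
  3≤ c = subst (3 ≤_) (sym (trans (length-map (c ,_) (tour rows)) (tour-length rows))) (≤-trans (n≤1+n 3) 4≤n)

-- The case m > 2 and n ≥ 6.

-- The first row `x` fixes the parity of the hexagon's left column; if `i` has the wrong parity, it
-- becomes the right column.
column-pair : ∀ {m n} → parity m ≡ 0ℙ → (i : Fin m) (x : Fin n) →
              ∃₂ λ c d → Next c d × i ∈ c ∷ d ∷ [] × c ⋈ x
column-pair em i x with opposite-or-equal (par i) (par x)
... | inj₁ i⋈x = i , _ , proj₂ (next i) , here refl , i⋈x
... | inj₂ i≡x = _ , i , proj₂ (prev i) , there (here refl) ,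
                 trans (opposite-sym _ _ (next-⋈ em (proj₂ (prev i)))) (cong _⁻¹ i≡x)

-- If `j` has the wrong parity for the first row of the hexagon, it becomes the middle row.
row-triple : ∀ {m n} → parity n ≡ 0ℙ → (c : Fin m) (j : Fin n) →
             ∃₂ λ x y → ∃ λ z → Next x y × Next y z × j ∈ x ∷ y ∷ z ∷ [] × c ⋈ x
row-triple en c j with opposite-or-equal (par c) (par j)
... | inj₁ c⋈j = j , _ , _ , proj₂ (next j) , proj₂ (next _) , here refl , c⋈j
... | inj₂ c≡j = _ , j , _ , proj₂ (prev j) , proj₂ (next j) , there (here refl) ,
                 trans c≡j (next-⋈ en (proj₂ (prev j)))

-- Only one coordinate has to avoid the second vertex, so the other is free to meet the parity
-- condition `c ⋈ x`.
separable-wide : ∀ {m n} → parity m ≡ 0ℙ → parity n ≡ 0ℙ → 3 ≤ m → 6 ≤ n →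
                 (u v : Vertex m n) → u ≢ v → Separable u v
separable-wide em en 3≤m 6≤n (i , j) (i′ , j′) u≢v with i ≟ i′
... | no i≢i′ =
  let c , d , cd , i∈ , i′∉ = pair-avoiding 3≤m i i′ i≢i′
      _ , _ , _ , xy , yz , j∈ , c⋈x = row-triple en c j
  in ring-separates (hexagon-factor em en 3≤m 6≤n cd xy yz c⋈x) i∈ j∈ (inj₁ i′∉)
... | yes refl =
  let x , _ , _ , xy , yz , j∈ , j′∉ = triple-avoiding (≤-trans (n≤1+n 5) 6≤n) j j′ (λ { refl → u≢v refl })
      _ , _ , cd , i∈ , c⋈x = column-pair em i x
  in ring-separates (hexagon-factor em en 3≤m 6≤n cd xy yz c⋈x) i∈ j∈ (inj₂ j′∉)

-- The obstruction for n = 4 and m > 2.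

even-row : (j : Fin 4) → par j ≡ 0ℙ → j ≡ 0F ⊎ j ≡ 2F
even-row 0F _ = inj₁ refl
even-row 2F _ = inj₂ refl
even-row 3F ()

parity-+*4 : ∀ r q → parity (r + q * 4) ≡ parity r
parity-+*4 r q = trans (+-homo-+ r (q * 4))
  (trans (cong (parity r ℙ.+_) (trans (*-homo-* q 4) (ℙ.*-zeroʳ (parity q)))) (ℙ.+-identityʳ (parity r)))

module _ {k : ℕ} (em : parity (3 + k) ≡ 0ℙ) where

  private
    Vtx : Set
    Vtx = Vertex (3 + k) 4
    _~_ : Vtx → Vtx → Set
    _~_ = Adj (3 + k) 4 0

  -- Since n = 4, both odd rows of a column have the same vertical neighbours, in rows 0 and 2; only
  -- the horizontal ones differ.
  OddNeighbours : Fin (3 + k) → Fin (3 + k) → Set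
  OddNeighbours a b = ∀ {r v} → par r ≡ 1ℙ → (a , r) ~ v → v ≡ (a , 0F) ⊎ v ≡ (a , 2F) ⊎ v ≡ (b , r)

  vertical-neighbour : ∀ {a b : Fin (3 + k)} {r j} → par r ≡ 1ℙ → j ⋈ r →
                       (a , j) ≡ (a , 0F) ⊎ (a , j) ≡ (a , 2F) ⊎ (a , j) ≡ (b , r)
  vertical-neighbour {j = j} r≡1 j⋈r with even-row j (trans j⋈r (cong _⁻¹ r≡1))
  ... | inj₁ refl = inj₁ refl
  ... | inj₂ refl = inj₂ (inj₁ refl)

  odd-neighbours₀ : OddNeighbours 0F 1F
  odd-neighbours₀ r≡1 (inj₁ (vertical s)) = vertical-neighbour r≡1 (next-⋈ refl s)
  odd-neighbours₀ r≡1 (inj₂ (vertical s)) = vertical-neighbour r≡1 (opposite-sym _ _ (next-⋈ refl s))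
  odd-neighbours₀ r≡1 (inj₁ (flat {i' = i′} i′≡1 _)) with refl ← toℕ-injective {j = 1F} i′≡1 = inj₂ (inj₂ refl)
  odd-neighbours₀ r≡1 (inj₂ (flat {i = i} 0≡i+1 _)) = contradiction (sym 0≡i+1) (n+1≢0 (toℕ i))
  odd-neighbours₀ r≡1 (inj₁ (jump () _ _ _))
  -- A jump starts in an even row, and reduction modulo 4 keeps parity, so it cannot land in the odd
  -- row `r`.
  odd-neighbours₀ {r} r≡1 (inj₂ (jump {j = j} _ _ j≡m (q , j+0≡r+q*4))) =
    contradiction (trans (sym r≡1) (trans (sym (parity-+*4 (toℕ r) q)) (trans (sym (cong parity j+0≡r+q*4)) j+0≡0))) λ ()
    where
    j+0≡0 : parity (toℕ j + 0) ≡ 0ℙ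
    j+0≡0 = even⇒parity (toℕ j + 0) (trans (cong (_% 2) (+-identityʳ (toℕ j))) (trans j≡m (parity⇒even (3 + k) em)))

  odd-neighbours₁ : OddNeighbours 1F 0F
  odd-neighbours₁ r≡1 (inj₁ (vertical s)) = vertical-neighbour r≡1 (next-⋈ refl s)
  odd-neighbours₁ r≡1 (inj₂ (vertical s)) = vertical-neighbour r≡1 (opposite-sym _ _ (next-⋈ refl s))
  -- Flat edges from column 1 to column 2 exist only in even rows.
  odd-neighbours₁ {1F} r≡1 (inj₁ (flat _ ()))
  odd-neighbours₁ {3F} r≡1 (inj₁ (flat _ ()))
  odd-neighbours₁ r≡1 (inj₂ (flat {i = 0F} _ _)) = inj₂ (inj₂ refl)
  odd-neighbours₁ r≡1 (inj₂ (flat {i = suc i} 1≡i+1 _)) = contradiction (sym (suc-injective 1≡i+1)) (n+1≢0 (toℕ i))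
  odd-neighbours₁ r≡1 (inj₁ (jump () _ _ _))
  odd-neighbours₁ r≡1 (inj₂ (jump _ () _ _))

  module _ {a b : Fin (3 + k)} (nbr : OddNeighbours a b) where

    -- A cycle uses two of the three possible neighbours of `(a , 1F)`, and the horizontal one is
    -- excluded.
    even-rows∈ : (C : Cycle Vtx _~_) → (a , 1F) ∈ verts C → (b , 1F) ∉ verts C →
                 (a , 0F) ∈ verts C × (a , 2F) ∈ verts C
    even-rows∈ C a∈ b∉ with neighbours adj-sym C a∈
    ... | y , z , y≢z , ay , az , y∈ , z∈ with nbr refl ay | nbr refl az
    ...   | inj₁ refl        | inj₁ refl        = contradiction refl y≢z
    ...   | inj₁ refl        | inj₂ (inj₁ refl) = y∈ , z∈
    ...   | inj₂ (inj₁ refl) | inj₁ refl        = z∈ , y∈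
    ...   | inj₂ (inj₁ refl) | inj₂ (inj₁ refl) = contradiction refl y≢z
    ...   | inj₂ (inj₂ refl) | _                = contradiction y∈ b∉
    ...   | _                | inj₂ (inj₂ refl) = contradiction z∈ b∉

    -- Without rows 0 and 2 only the horizontal neighbour remains, and a cycle needs two.
    row-3∉ : (C : Cycle Vtx _~_) → (a , 0F) ∉ verts C → (a , 2F) ∉ verts C → (a , 3F) ∉ verts C
    row-3∉ C 0∉ 2∉ a∈ with neighbours adj-sym C a∈
    ... | y , z , y≢z , ay , az , y∈ , z∈ with nbr refl ay | nbr refl az
    ...   | inj₁ refl        | _                = 0∉ y∈
    ...   | inj₂ (inj₁ refl) | _                = 2∉ y∈
    ...   | inj₂ (inj₂ refl) | inj₁ refl        = 0∉ z∈
    ...   | inj₂ (inj₂ refl) | inj₂ (inj₁ refl) = 2∉ z∈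
    ...   | inj₂ (inj₂ refl) | inj₂ (inj₂ refl) = y≢z refl

    -- With the horizontal neighbours off the cycle, rows 1 and 3 share the neighbours in rows 0 and
    -- 2, so `four-cycle` closes the cycle inside the column.
    within-column : (C : Cycle Vtx _~_) → (a , 1F) ∈ verts C → (a , 3F) ∈ verts C →
                    (b , 1F) ∉ verts C → (b , 3F) ∉ verts C → ∀ {v} → v ∈ verts C → proj₁ v ≡ a
    within-column C 1∈ 3∈ b1∉ b3∉ v∈
      with four-cycle adj-sym C 1∈ 3∈ (λ ()) (λ ()) (λ ()) (restrict b1∉ refl) (restrict b3∉ refl) v∈
      where
      restrict : ∀ {r} → (b , r) ∉ verts C → par r ≡ 1ℙ → ∀ {v} → v ∈ verts C → (a , r) ~ v →
                 v ≡ (a , 0F) ⊎ v ≡ (a , 2F)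
      restrict b∉ r≡1 v∈ av with nbr r≡1 av
      ... | inj₁ v≡               = inj₁ v≡
      ... | inj₂ (inj₁ v≡)        = inj₂ v≡
      ... | inj₂ (inj₂ refl)      = contradiction v∈ b∉
    ... | inj₁ refl               = refl
    ... | inj₂ (inj₁ refl)        = refl
    ... | inj₂ (inj₂ (inj₁ refl)) = refl
    ... | inj₂ (inj₂ (inj₂ refl)) = refl

  -- Each cycle claims rows 0 and 2 of its own column, which keeps row 3 of that column off the
  -- other cycle. Both cycles then stay inside columns 0 and 1 and miss `(2F , 0F)`.
  not-separable : ¬ Separable {3 + k} {4} (0F , 1F) (1F , 1F)
  not-separable (F , u∈ , v∈) = either
    (λ x∈ → contradiction (within-column odd-neighbours₀ C₁ u∈ 03∈ v∉ 13∉ x∈) λ ())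
    (λ x∈ → contradiction (within-column odd-neighbours₁ C₂ v∈ 13∈ u∉ 03∉ x∈) λ ())
    (spanning F (2F , 0F))
    where
    C₁ = cyc₁ F
    C₂ = cyc₂ F
    v∉ : (1F , 1F) ∉ verts C₁
    v∉ h = disjoint F _ h v∈
    u∉ : (0F , 1F) ∉ verts C₂
    u∉ = disjoint F _ u∈
    E₁ = even-rows∈ odd-neighbours₀ C₁ u∈ v∉
    E₂ = even-rows∈ odd-neighbours₁ C₂ v∈ u∉
    03∉ : (0F , 3F) ∉ verts C₂
    03∉ = row-3∉ odd-neighbours₀ C₂ (disjoint F _ (proj₁ E₁)) (disjoint F _ (proj₂ E₁))
    13∉ : (1F , 3F) ∉ verts C₁
    13∉ = row-3∉ odd-neighbours₁ C₁ (λ h → disjoint F _ h (proj₁ E₂)) (λ h → disjoint F _ h (proj₂ E₂))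
    03∈ : (0F , 3F) ∈ verts C₁
    03∈ = fromInj₁ (λ h → contradiction h 03∉) (spanning F (0F , 3F))
    13∈ : (1F , 3F) ∈ verts C₂
    13∈ = fromInj₂ (λ h → contradiction h 13∉) (spanning F (1F , 3F))

-- Both directions, by cases on m = 2 and n = 4.

theorem5p1 : ∀ (m n : ℕ) → 2 ≤ m → m % 2 ≡ 0 → 4 ≤ n → n % 2 ≡ 0 →
    (HTG2SC m n 0 ⇔ (4 < n ⊎ (m ≡ 2 × n ≡ 4)))
theorem5p1 m n 2≤m m-even 4≤n n-even =
  mk⇔ (necessary (m≤n⇒m<n∨m≡n 2≤m) (m≤n⇒m<n∨m≡n 4≤n)) (sufficient (m≤n⇒m<n∨m≡n 2≤m))
  where
  em = even⇒parity m m-even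
  en = even⇒parity n n-even

  necessary : 2 < m ⊎ 2 ≡ m → 4 < n ⊎ 4 ≡ n → HTG2SC m n 0 → 4 < n ⊎ (m ≡ 2 × n ≡ 4)
  necessary _                            (inj₁ 4<n)  _ = inj₁ 4<n
  necessary (inj₂ refl)                  (inj₂ refl) _ = inj₂ (refl , refl)
  -- Matching on `2 < m` exposes `m` as `3 + k`, so columns 0, 1 and 2 exist.
  necessary (inj₁ (s≤s (s≤s (s≤s z≤n)))) (inj₂ refl) h =
    contradiction (h (0F , 1F) (1F , 1F) λ ()) (not-separable em)

  6≤n : 4 < n → 6 ≤ n
  6≤n 4<n with m≤n⇒m<n∨m≡n 4<n
  ... | inj₁ 5<n  = 5<n
  ... | inj₂ refl = contradiction n-even λ ()

  sufficient : 2 < m ⊎ 2 ≡ m → 4 < n ⊎ (m ≡ 2 × n ≡ 4) → HTG2SC m n 0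
  sufficient (inj₂ refl) _                 = separable-prism 4≤n
  sufficient (inj₁ 2<m)  (inj₁ 4<n)        = separable-wide em en 2<m (6≤n 4<n)
  sufficient (inj₁ 2<2)  (inj₂ (refl , _)) = contradiction 2<2 (<-irrefl refl)
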